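{- Let $k\in\{1,2,3\}$. There exists a constant $c_k$, depending only on $k$, such that for every $A\in C_k$, every $a\in A\setminus E_k$, and every positive integer $n$, $$|A(n)|\le \frac{(P_k-\varphi(P_k))\,a-\varphi(P_{k-1})(p_{k+1}-p_k)}{P_k\, a}\,n+c_k.$$
   Context: Let $\mathbb{Z}^{+}$ be the set of positive integers, $p_i$ the $i$th prime, $P_k=p_1p_2\cdots p_k$ (with $P_0=1$, the empty product), and $\varphi$ Euler's totient function. $C_k$ is the family of all subsets $A\subseteq\mathbb{Z}^{+}$ that do not contain $k+1$ pairwise coprime integers. $E_k$ is the set of positive integers divisible by at least one of $p_1,\ldots,p_k$. For $A\subseteq\mathbb{Z}^{+}$, $A(n)=A\cap\{1,2,\ldots,n\}$, and $|A(n)|$ is its number of elements.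
   Formalization: The k+1 pairwise coprime integers may repeat, so no A in C_k contains 1; with distinct integers the claim fails for k=2, a=1, A={1} together with the even numbers. Sets containing 1 with a>1 follow by removing 1 and raising c_k by one. -}

module Defs where

open import Data.Integer.Base as ℤ using (+_)
open import Data.List.Base using ([]; _∷_; length; filter; map; upTo)
open import Data.List.Membership.Propositional using () renaming (_∈_ to _∈ˡ_)
open import Data.List.Relation.Unary.Unique.Propositional using (Unique)
open import Data.Nat.Base using (ℕ; zero; suc; _*_; _∸_; _≤_; _!; NonZero; nonZero)
open import Data.Nat.Coprimality using (Coprime; coprime?)
open import Data.Nat.Divisibility using (_∣_)
open import Data.Nat.Primality using (prime?)
open import Data.Nat.Properties using (m*n≢0)
open import Data.Product.Base using (∃-syntax; _×_)
open import Data.Rational.Base using (ℚ; _/_)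
open import Data.Vec.Base using (Vec)
open import Data.Vec.Relation.Unary.All using (All)
open import Data.Vec.Relation.Unary.AllPairs using (AllPairs)
open import Function.Bundles using (_⇔_)
open import Level using (0ℓ)
open import Relation.Binary.PropositionalEquality using (_≡_; refl)
open import Relation.Nullary using (¬_; yes; no)
open import Relation.Unary using (Pred; _∈_)

-- The first prime among m, m + 1, …, m + fuel - 1, or m + fuel if there is none.
searchPrime : (fuel m : ℕ) → ℕ
searchPrime zero       m = m
searchPrime (suc fuel) m with prime? m
... | yes _ = m
... | no  _ = searchPrime fuel (suc m)

-- The least prime above n.  The fuel suffices: any prime factor q of n ! + 1
-- satisfies n < q ≤ n ! + 1 (Euclid).
nextPrime : ℕ → ℕ
nextPrime n = searchPrime (n !) (suc n)

-- p i is the i-th prime for i ≥ 1; p 0 is only the seed of the recursion.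
p : ℕ → ℕ
p zero    = 0
p (suc i) = nextPrime (p i)

_ : map p (1 ∷ 2 ∷ 3 ∷ 4 ∷ 5 ∷ []) ≡ 2 ∷ 3 ∷ 5 ∷ 7 ∷ 11 ∷ []
_ = refl

P : ℕ → ℕ
P zero    = 1
P (suc k) = P k * p (suc k)

φ : ℕ → ℕ
φ n = length (filter (coprime? n) (map suc (upTo n)))

-- Subsets of ℤ⁺ are predicates on ℕ that imply NonZero.
--
-- "k + 1 pairwise coprime integers of A" are x₁, …, xₖ₊₁ ∈ A with
-- gcd(xᵢ , xⱼ) = 1 for i < j.  Such xᵢ are automatically distinct unless some
-- are 1; since 1 is coprime to itself, no member of C k contains 1.  If
-- distinctness were required, {1} ∪ 2ℤ⁺ would belong to C 2 and, having
-- density 1/2, refute the bound (whose slope is 1/3) for k = 2, a = 1.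
C : ℕ → Pred (Pred ℕ 0ℓ) 0ℓ
C k A = (∀ {x} → x ∈ A → NonZero x)
      × (∀ (xs : Vec ℕ (suc k)) → All A xs → ¬ AllPairs Coprime xs)

E : ℕ → Pred ℕ 0ℓ
E k x = NonZero x × ∃[ i ] 1 ≤ i × i ≤ k × p i ∣ x

_⟨_⟩ : Pred ℕ 0ℓ → ℕ → Pred ℕ 0ℓ
(A ⟨ n ⟩) x = x ∈ A × 1 ≤ x × x ≤ n

-- A is not assumed decidable, so cardinality is a relation rather than a
-- function: S is listed without repetition by a list of length m.
∣_∣≡_ : Pred ℕ 0ℓ → ℕ → Set
∣ S ∣≡ m = ∃[ xs ] Unique xs × (∀ x → x ∈ˡ xs ⇔ x ∈ S) × length xs ≡ m

ι : ℕ → ℚ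
ι n = + n / 1

searchPrime-nonZero : ∀ fuel m → .{{_ : NonZero m}} → NonZero (searchPrime fuel m)
searchPrime-nonZero zero       (suc _) = nonZero
searchPrime-nonZero (suc fuel) m@(suc _) with prime? m
... | yes _ = nonZero
... | no  _ = searchPrime-nonZero fuel (suc m)

P-nonZero : ∀ k → NonZero (P k)
P-nonZero zero    = nonZero
P-nonZero (suc k) =
  m*n≢0 (P k) (p (suc k))
    {{P-nonZero k}} {{searchPrime-nonZero (p k !) (suc (p k))}}

-- The subtractions are in ℤ, so nothing is truncated.
slope : (k a : ℕ) → .{{NonZero a}} → ℚ
slope k a =
  ( (+ P k ℤ.- + φ (P k)) ℤ.* + a
    ℤ.- + φ (P (k ∸ 1)) ℤ.* (+ p (suc k) ℤ.- + p k)
  ) / (P k * a)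
  where
  instance
    P*a-nonZero : NonZero (P k * a)
    P*a-nonZero = m*n≢0 (P k) a {{P-nonZero k}}

{-# OPTIONS --safe #-}

-- Put M = P k and cut ℤ⁺ into blocks of M consecutive integers.  If i - j has
-- only prime factors of M, then whether b M + i and b M + j are coprime depends
-- only on i and j.  So the same (k + 1)-tuples of positions are pairwise
-- coprime in every block, A misses a member of each, and a finite search
-- for hitting sets shows that it misses at least φ(M) elements of the block.
--
-- An integer x + i, where a ∣ x and i has only prime factors of M, is coprime to
-- a, so among these integers already the pairwise coprime k-tuples are hit.
-- When x modulo M lies in a suitable set W of residues this costs A one more
-- element of the block.  As a is a unit modulo M and W is closed under
-- multiplication by units, the multiples t a with t ∈ W do so, in distinct
-- blocks.  Hence A loses φ(P (k - 1)) (p (k + 1) - p k) = |W| further elements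
-- in every M a consecutive integers.
module Submission where

open import Defs
open import Data.Bool.Base using (Bool; true; false; T; _∧_; _∨_; if_then_else_)
open import Data.Bool.Properties using (T-∧; T-∨)
open import Data.Integer.Base as ℤ using (ℤ)
import Data.Integer.Properties as ℤ
import Data.Integer.Tactic.RingSolver as ℤ-Ring
open import Data.List.Base
  using (List; []; _∷_; _++_; applyUpTo; concat; filter; length; map; upTo)
open import Data.List.Membership.Propositional using (find; lose)
  renaming (_∈_ to _∈ˡ_; _∉_ to _∉ˡ_)
open import Data.List.Membership.Propositional.Properties
open import Data.List.Properties
  using (filter-notAll; length-map; length-++; length-upTo; map-++; map-cong; map-upTo)
open import Data.List.Relation.Binary.Permutation.Propositional using (_↭_; ↭-refl; ↭-trans; prep)
import Data.List.Relation.Binary.Permutation.Propositional.Properties as ↭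
open import Data.List.Relation.Unary.All as Listᵃ using ([]; _∷_)
import Data.List.Relation.Unary.All.Properties as Listᵃ
open import Data.List.Relation.Unary.Any as Any using (Any; here; there)
open import Data.List.Relation.Unary.Unique.Propositional using (Unique)
open import Data.List.Relation.Unary.AllPairs as Listᵖ using ([]; _∷_)
import Data.List.Relation.Unary.AllPairs.Properties as Listᵖ
open import Data.Nat.Base
open import Data.Nat.Coprimality as Coprimality using (Coprime; coprime?; coprime-divisor)
open import Data.Nat.Divisibility
open import Data.Nat.DivMod
open import Data.Nat.ListAction using (sum)
open import Data.Nat.ListAction.Properties using (sum-++; sum-↭)
open import Data.Nat.Primality using (Prime; prime?; prime⇒irreducible)
open import Data.Nat.Properties
open import Data.Nat.Tactic.RingSolver using (solve-∀)
open import Data.List.Membership.DecPropositional _≟_ using (_∈?_; _∉?_)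
open import Data.Product.Base using (Σ-syntax; ∃-syntax; _×_; _,_; proj₁; proj₂)
open import Data.Rational.Base as ℚ using (ℚ)
import Data.Rational.Properties as ℚ
open import Data.Rational.Unnormalised.Base as ℚᵘ using (mkℚᵘ; *≤*)
import Data.Rational.Unnormalised.Properties as ℚᵘ
open import Data.Sum.Base using (inj₁; inj₂)
open import Data.Vec.Base as Vec using (Vec; []; _∷_; toList)
open import Data.Vec.Relation.Unary.All as Vecᵃ using ([]; _∷_)
import Data.Vec.Relation.Unary.All.Properties as Vecᵃ
open import Data.Vec.Relation.Unary.AllPairs as Vecᵖ using (AllPairs; []; _∷_)
import Data.Vec.Relation.Unary.AllPairs.Properties as Vecᵖ
open import Function.Base using (_∘_)
open import Function.Bundles using (Equivalence)
open import Level using (0ℓ)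
open import Relation.Binary.Core using (Rel)
open import Relation.Binary.Definitions using (Decidable)
open import Relation.Binary.PropositionalEquality
  using (_≡_; _≢_; refl; sym; trans; cong; cong₂; subst; subst₂; module ≡-Reasoning)
open import Relation.Nullary using (¬_; Dec; does; yes; no; contradiction)
open import Relation.Nullary.Decidable using (¬?; _×-dec_; _→-dec_; from-yes)
open import Relation.Unary using (Pred; _∈_; _∉_)
import Relation.Unary as U

-- Hitting sets

remove : ℕ → List ℕ → List ℕ
remove v = filter (λ x → ¬? (x ≟ v))

remove-< : ∀ {v H} → v ∈ˡ H → length (remove v H) < length H
remove-< v∈H = filter-notAll _ _ (Any.map (λ v≡x x≢v → x≢v (sym v≡x)) v∈H)

_Hits_ : List ℕ → List (List ℕ) → Set
H Hits cs = Listᵃ.All (Any (_∈ˡ H)) cs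

pack : List ℕ → List (List ℕ) → ℕ
pack used []       = 0
pack used (c ∷ cs) =
  if does (Listᵃ.all? (_∉? used) c) then suc (pack (c ++ used) cs) else pack used cs

-- The chosen cliques are disjoint, so each needs its own element of `H`: the `v` that hits `c` can
-- be removed, as it hits no clique avoiding `c`. Requiring hits only for cliques that avoid `used`
-- is the form that survives the induction.
pack-≤ : ∀ used cs {H} →
         Listᵃ.All (λ c → Listᵃ.All (_∉ˡ used) c → Any (_∈ˡ H) c) cs →
         pack used cs ≤ length H
pack-≤ used []       _            = z≤n
pack-≤ used (c ∷ cs) {H} (hit ∷ hits) with Listᵃ.all? (_∉? used) c
... | no  _   = pack-≤ used cs hits
... | yes new with v , v∈c , v∈H ← find (hit new) =
  ≤-trans (s≤s (pack-≤ (c ++ used) cs (Listᵃ.map avoid hits))) (remove-< v∈H)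
  where
  avoid : ∀ {d} → (Listᵃ.All (_∉ˡ used) d → Any (_∈ˡ H) d) →
          Listᵃ.All (_∉ˡ (c ++ used)) d → Any (_∈ˡ remove v H) d
  avoid hit′ d∌ with w , w∈d , w∈H ← find (hit′ (Listᵃ.map (_∘ ∈-++⁺ʳ c) d∌)) =
    lose w∈d (∈-filter⁺ _ w∈H λ { refl → Listᵃ.lookup d∌ w∈d (∈-++⁺ˡ v∈c) })

-- Decides "no k - 1 numbers hit all of cs" by branching on whether the first
-- element of the first clique is in the hitting set; a branch closes when
-- disjoint cliques alone require k numbers.  false is inconclusive.
search : (fuel k : ℕ) → List (List ℕ) → Bool
search zero       _       _               = false
search (suc fuel) zero    _               = true
search (suc fuel) (suc k) []              = false
search (suc fuel) (suc k) ([] ∷ _)        = true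
search (suc fuel) (suc k) cs@((v ∷ _) ∷ _) =
  (k <ᵇ pack [] cs) ∨
  search fuel k (filter (v ∉?_) cs) ∧ search fuel (suc k) (map (remove v) cs)

-- If `v` is in `H`, the cliques without `v` are hit by the rest of `H`; otherwise every clique is
-- still hit after `v` is deleted from it.
search-≤ : ∀ fuel k cs {H} → T (search fuel k cs) → H Hits cs → k ≤ length H
search-≤ (suc fuel) zero    _        _ _          = z≤n
search-≤ (suc fuel) (suc k) ([] ∷ _) _ (() ∷ _)
search-≤ (suc fuel) (suc k) cs@((v ∷ _) ∷ _) {H} ok hits
  with Equivalence.to T-∨ ok
... | inj₁ k<pack = ≤-trans (<ᵇ⇒< k _ k<pack) (pack-≤ [] cs (Listᵃ.map (λ hit _ → hit) hits))
... | inj₂ ok′ with Equivalence.to (T-∧ {search fuel k (filter (v ∉?_) cs)}) ok′ | v ∈? H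
...   | okˡ , _ | yes v∈H =
  ≤-trans (s≤s (search-≤ fuel k _ okˡ (Listᵃ.tabulate avoid))) (remove-< v∈H)
  where
  avoid : ∀ {c} → c ∈ˡ filter (v ∉?_) cs → Any (_∈ˡ remove v H) c
  avoid c∈ with c∈cs , v∉c ← ∈-filter⁻ (v ∉?_) c∈
           with w , w∈c , w∈H ← find (Listᵃ.lookup hits c∈cs) =
    lose w∈c (∈-filter⁺ _ w∈H λ { refl → v∉c w∈c })
...   | _ , okʳ | no v∉H =
  search-≤ fuel (suc k) _ okʳ (Listᵃ.map⁺ (Listᵃ.map delete hits))
  where
  delete : ∀ {c} → Any (_∈ˡ H) c → Any (_∈ˡ H) (remove v c)
  delete hit with w , w∈c , w∈H ← find hit =
    lose (∈-filter⁺ _ w∈c λ { refl → v∉H w∈H }) w∈H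

length-filter+length-filter-¬ :
  ∀ {Q : Pred ℕ 0ℓ} (Q? : U.Decidable Q) xs →
  length (filter Q? xs) + length (filter (¬? ∘ Q?) xs) ≡ length xs
length-filter+length-filter-¬ Q? []       = refl
length-filter+length-filter-¬ Q? (x ∷ xs) with Q? x
... | yes _ = cong suc (length-filter+length-filter-¬ Q? xs)
... | no  _ = trans (+-suc _ _) (cong suc (length-filter+length-filter-¬ Q? xs))

-- The elements of `U` that fail `Q` form a hitting set, so there are at least `k` of them.
search-count : ∀ {Q : Pred ℕ 0ℓ} (Q? : U.Decidable Q) fuel k {U cs} → T (search fuel k cs) →
               (∀ {c} → c ∈ˡ cs → Listᵃ.All (_∈ˡ U) c × ¬ Listᵃ.All Q c) →
               length (filter Q? U) + k ≤ length U
search-count {Q} Q? fuel k {U} {cs} ok excluded = begin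
  length (filter Q? U) + k                             ≤⟨ +-monoʳ-≤ _ (search-≤ fuel k cs ok (Listᵃ.tabulate hit)) ⟩
  length (filter Q? U) + length (filter (¬? ∘ Q?) U)   ≡⟨ length-filter+length-filter-¬ Q? U ⟩
  length U                                             ∎
  where
  open ≤-Reasoning
  hit : ∀ {c} → c ∈ˡ cs → Any (_∈ˡ filter (¬? ∘ Q?) U) c
  hit c∈cs with c⊆U , ¬Qc ← excluded c∈cs
           with v , v∈c , ¬Qv ← find (Listᵃ.¬All⇒Any¬ Q? _ ¬Qc) =
    lose v∈c (∈-filter⁺ _ (Listᵃ.lookup c⊆U v∈c) ¬Qv)

-- Coprimality forced by position

coprime-^⇒≡1 : ∀ {d m} e → Coprime d m → d ∣ m ^ e → d ≡ 1
coprime-^⇒≡1 zero    _   d∣1 = ∣1⇒≡1 d∣1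
coprime-^⇒≡1 (suc e) d⊥m d∣m = coprime-^⇒≡1 e d⊥m (coprime-divisor d⊥m d∣m)

∣m∣n⇒∣∣m-n∣ : ∀ {d m n} → d ∣ m → d ∣ n → d ∣ ∣ m - n ∣
∣m∣n⇒∣∣m-n∣ {d} (divides-refl q) (divides-refl r) = divides ∣ q - r ∣ (sym (*-distribʳ-∣-∣ d q r))

∣-gap : ∀ {d} β i j → d ∣ β + i → d ∣ β + j → d ∣ ∣ i - j ∣
∣-gap {d} β i j p q = subst (d ∣_) (∣m+n-m+o∣≡∣n-o∣ β i j) (∣m∣n⇒∣∣m-n∣ p q)

-- ∣ i - j ∣ ∣ M ^ 5 says that the gap is nonzero with all its prime factors
-- dividing M: the exponents of primes in gaps up to 30 are below 5.
Apart : ℕ → Rel ℕ 0ℓ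
Apart M i j = Coprime i ∣ i - j ∣ × ∣ i - j ∣ ∣ M ^ 5

apart? : ∀ M → Decidable (Apart M)
apart? M i j = coprime? i ∣ i - j ∣ ×-dec ∣ i - j ∣ ∣? M ^ 5

-- A common divisor `d` divides the gap. A common divisor of `d` and `M` divides both `i` and the
-- gap, hence is 1. So `d` is coprime to `M` and yet divides `M ^ 5`.
apart⇒coprime : ∀ {M β i j} → M ∣ β → Apart M i j → Coprime (β + i) (β + j)
apart⇒coprime {M} {β} {i} {j} M∣β (i⊥δ , δ∣M⁵) {d} (d∣β+i , d∣β+j) =
  coprime-^⇒≡1 5 d⊥M (∣-trans d∣δ δ∣M⁵)
  where
  d∣δ = ∣-gap β i j d∣β+i d∣β+j
  d⊥M : Coprime d M
  d⊥M (e∣d , e∣M) =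
    i⊥δ (∣m+n∣m⇒∣n (∣-trans e∣d d∣β+i) (∣-trans e∣M M∣β) , ∣-trans e∣d d∣δ)

-- Since `a` is already coprime to `M`, it is enough that the gap divides a power of `M`; `i` may
-- share factors with the gap.
near⇒coprime : ∀ {M a} β i s → Coprime a M → a ∣ β + s → ∣ i - s ∣ ∣ M ^ 5 → Coprime a (β + i)
near⇒coprime β i s a⊥M a∣β+s δ∣M⁵ (d∣a , d∣β+i) =
  coprime-^⇒≡1 5 (λ (e∣d , e∣M) → a⊥M (∣-trans e∣d d∣a , e∣M))
    (∣-trans (∣-gap β i s d∣β+i (∣-trans d∣a a∣β+s)) δ∣M⁵)

-- Cliques of positions and the count in one block

cliques : ∀ {R : Rel ℕ 0ℓ} → Decidable R → (r : ℕ) → List ℕ → List (Vec ℕ r)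
cliques R? zero    _        = [] ∷ []
cliques R? (suc r) []       = []
cliques R? (suc r) (v ∷ vs) = map (v ∷_) (cliques R? r (filter (R? v) vs)) ++ cliques R? (suc r) vs

cliques-sound : ∀ {R : Rel ℕ 0ℓ} (R? : Decidable R) r vs {c} → c ∈ˡ cliques R? r vs →
                AllPairs R c × Vecᵃ.All (_∈ˡ vs) c
cliques-sound R? zero    _        (here refl) = [] , []
cliques-sound R? (suc r) (v ∷ vs) c∈ with ∈-++⁻ (map (v ∷_) (cliques R? r (filter (R? v) vs))) c∈
... | inj₁ c∈ˡ with _ , c′∈ , refl ← ∈-map⁻ (v ∷_) c∈ˡ
               with pairs , mem ← cliques-sound R? r _ c′∈ =
  Vecᵃ.map (proj₂ ∘ ∈-filter⁻ (R? v) {xs = vs}) mem ∷ pairs ,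
  here refl ∷ Vecᵃ.map (there ∘ proj₁ ∘ ∈-filter⁻ (R? v)) mem
... | inj₂ c∈ʳ with pairs , mem ← cliques-sound R? (suc r) vs c∈ʳ = pairs , Vecᵃ.map there mem

-- Block j consists of the integers j * M + i with i in positions M.
positions : ℕ → List ℕ
positions M = map suc (upTo M)

length-positions : ∀ M → length (positions M) ≡ M
length-positions M = trans (length-map suc (upTo M)) (length-upTo M)

near? : ∀ M s i → Dec (∣ i - s ∣ ∣ M ^ 5)
near? M s i = ∣ i - s ∣ ∣? M ^ 5

plainCliques : (k M : ℕ) → List (List ℕ)
plainCliques k M = map toList (cliques (apart? M) (suc k) (positions M))

-- These have size `k`, one less than the plain cliques, because `a` is to be the remaining member.
-- For nonzero `M`, position `s` is not near itself, as 0 does not divide `M ^ 5`.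
markedCliques : (k M s : ℕ) → List (List ℕ)
markedCliques k M s = map toList (cliques (apart? M) k (filter (near? M s) (positions M)))

module Blocks {A k} (A∈C : A ∈ C k) {xs : List ℕ} (xs⊆A : ∀ {x} → x ∈ˡ xs → x ∈ A) (M : ℕ) where

  -- Membership in the finite list `xs` is decidable, whereas `A` is not assumed to be; exclusions
  -- for `A` carry over to `xs`.
  Occupied : ℕ → Pred ℕ 0ℓ
  Occupied j i = j * M + i ∈ˡ xs

  occupied? : ∀ j → U.Decidable (Occupied j)
  occupied? j i = j * M + i ∈? xs

  count : ℕ → ℕ
  count j = length (filter (occupied? j) (positions M))

  translate : ∀ {r} j {c : Vec ℕ r} → AllPairs (Apart M) c → AllPairs Coprime (Vec.map (j * M +_) c)
  translate j = Vecᵖ.map⁺ ∘ Vecᵖ.map (apart⇒coprime (n∣m*n j))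

  occupied⇒A : ∀ {r} j {c : Vec ℕ r} → Listᵃ.All (Occupied j) (toList c) →
               Vecᵃ.All A (Vec.map (j * M +_) c)
  occupied⇒A j = Vecᵃ.map⁺ ∘ Vecᵃ.map xs⊆A ∘ Vecᵃ.toList⁻

  plain-excluded : ∀ j {c} → c ∈ˡ plainCliques k M →
                   Listᵃ.All (_∈ˡ positions M) c × ¬ Listᵃ.All (Occupied j) c
  plain-excluded j c∈ with c , c∈ , refl ← ∈-map⁻ toList c∈
                      with pairs , mem ← cliques-sound (apart? M) (suc k) (positions M) c∈ =
    Vecᵃ.toList⁺ mem , λ occ → proj₂ A∈C _ (occupied⇒A j occ) (translate j pairs)

  -- The translated clique together with `a` would give `k + 1` pairwise coprime members of `A`.
  marked-excluded : ∀ {a} → a ∈ A → Coprime a M → ∀ j s → a ∣ j * M + s →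
                    ∀ {c} → c ∈ˡ markedCliques k M s →
                    Listᵃ.All (_∈ˡ positions M) c × ¬ Listᵃ.All (Occupied j) c
  marked-excluded a∈A a⊥M j s a∣ c∈
    with c , c∈ , refl ← ∈-map⁻ toList c∈
    with pairs , mem ← cliques-sound (apart? M) k (filter (near? M s) (positions M)) c∈ =
    Vecᵃ.toList⁺ (Vecᵃ.map (proj₁ ∘ ∈-filter⁻ (near? M s)) mem) ,
    λ occ → proj₂ A∈C (_ ∷ _) (a∈A ∷ occupied⇒A j occ)
      (Vecᵃ.map⁺ (Vecᵃ.map (near⇒coprime (j * M) _ s a⊥M a∣ ∘ proj₂ ∘ ∈-filter⁻ (near? M s) {xs = positions M}) mem)
        ∷ translate j pairs)

  count-≤ : ∀ fuel d → T (search fuel d (plainCliques k M)) → ∀ j → count j + d ≤ M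
  count-≤ fuel d ok j =
    subst (count j + d ≤_) (length-positions M) (search-count (occupied? j) fuel d ok (plain-excluded j))

  count-marked-≤ : ∀ {a} → a ∈ A → Coprime a M → ∀ fuel d j s → a ∣ j * M + s →
                   T (search fuel d (markedCliques k M s ++ plainCliques k M)) → count j + d ≤ M
  count-marked-≤ a∈A a⊥M fuel d j s a∣ ok =
    subst (count j + d ≤_) (length-positions M) (search-count (occupied? j) fuel d ok excluded)
    where
    excluded : ∀ {c} → c ∈ˡ markedCliques k M s ++ plainCliques k M → _
    excluded c∈ with ∈-++⁻ (markedCliques k M s) c∈
    ... | inj₁ c∈ˡ = marked-excluded a∈A a⊥M j s a∣ c∈ˡ
    ... | inj₂ c∈ʳ = plain-excluded j c∈ʳ

-- Sums over blocks

unique-⊆⇒↭-++ : ∀ {xs ys : List ℕ} → Unique xs → (∀ {x} → x ∈ˡ xs → x ∈ˡ ys) →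
                ∃[ zs ] ys ↭ xs ++ zs
unique-⊆⇒↭-++ {[]}     {ys} _           _     = ys , ↭-refl
unique-⊆⇒↭-++ {x ∷ xs} (x∉xs ∷ xs!) xs⊆ys
  with us , vs , refl ← ∈-∃++ (xs⊆ys (here refl)) =
  let zs , p = unique-⊆⇒↭-++ xs! rest in zs , ↭-trans (↭.shift x us vs) (prep x p)
  where
  rest : ∀ {y} → y ∈ˡ xs → y ∈ˡ us ++ vs
  rest y∈xs with ∈-++⁻ us (xs⊆ys (there y∈xs))
  ... | inj₁ y∈us         = ∈-++⁺ˡ y∈us
  ... | inj₂ (here refl)  = contradiction refl (Listᵃ.lookup x∉xs y∈xs)
  ... | inj₂ (there y∈vs) = ∈-++⁺ʳ us y∈vs

unique-⊆⇒length-≤ : ∀ {xs ys : List ℕ} → Unique xs → (∀ {x} → x ∈ˡ xs → x ∈ˡ ys) →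
                    length xs ≤ length ys
unique-⊆⇒length-≤ {xs} xs! xs⊆ys with zs , p ← unique-⊆⇒↭-++ xs! xs⊆ys =
  subst (length xs ≤_) (sym (trans (↭.↭-length p) (length-++ xs))) (m≤m+n _ _)

length-concat-applyUpTo : ∀ (f : ℕ → List ℕ) N →
                          length (concat (applyUpTo f N)) ≡ sum (applyUpTo (length ∘ f) N)
length-concat-applyUpTo f zero    = refl
length-concat-applyUpTo f (suc N) =
  trans (length-++ (f 0)) (cong (_ +_) (length-concat-applyUpTo (f ∘ suc) N))

applyUpTo-+ : ∀ (f : ℕ → ℕ) m n →
              applyUpTo f (m + n) ≡ applyUpTo f m ++ applyUpTo (f ∘ (m +_)) n
applyUpTo-+ f zero    n = refl
applyUpTo-+ f (suc m) n = cong (f 0 ∷_) (applyUpTo-+ (f ∘ suc) m n)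

sum-map-suc : ∀ (g : ℕ → ℕ) J → sum (map (suc ∘ g) J) ≡ sum (map g J) + length J
sum-map-suc g []      = refl
sum-map-suc g (j ∷ J) = begin
  suc (g j) + sum (map (suc ∘ g) J)      ≡⟨ cong (suc (g j) +_) (sum-map-suc g J) ⟩
  suc (g j) + (sum (map g J) + length J) ≡⟨ cong suc (+-assoc (g j) _ _) ⟨
  suc (g j + sum (map g J) + length J)   ≡⟨ +-suc _ _ ⟨
  g j + sum (map g J) + suc (length J)   ∎
  where open ≡-Reasoning

sum-map-≤ : ∀ {g : ℕ → ℕ} {B L} → Listᵃ.All (λ j → g j ≤ B) L → sum (map g L) ≤ length L * B
sum-map-≤ []         = z≤n
sum-map-≤ (g≤ ∷ gs≤) = +-mono-≤ g≤ (sum-map-≤ gs≤)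

-- The range below `a` is rearranged with `J` in front, and each term from `J` absorbs one unit of
-- `length J`.
sum-with-savings : ∀ {g : ℕ → ℕ} {B J a} → Unique J → Listᵃ.All (_< a) J →
                   (∀ j → g j ≤ B) → Listᵃ.All (λ j → suc (g j) ≤ B) J →
                   sum (applyUpTo g a) + length J ≤ a * B
sum-with-savings {g} {B} {J} {a} J! J<a g≤B saving
  with R , p ← unique-⊆⇒↭-++ {ys = upTo a} J! (λ j∈J → ∈-upTo⁺ (Listᵃ.lookup J<a j∈J)) = begin
  sum (applyUpTo g a) + length J                  ≡⟨ cong (λ l → sum l + length J) (map-upTo g a) ⟨
  sum (map g (upTo a)) + length J                 ≡⟨ cong (_+ length J) (sum-↭ (↭.map⁺ g p)) ⟩
  sum (map g (J ++ R)) + length J                 ≡⟨ cong (λ l → sum l + length J) (map-++ g J R) ⟩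
  sum (map g J ++ map g R) + length J             ≡⟨ cong (_+ length J) (sum-++ (map g J) (map g R)) ⟩
  sum (map g J) + sum (map g R) + length J        ≡⟨ shuffle (sum (map g J)) (sum (map g R)) (length J) ⟩
  sum (map g J) + length J + sum (map g R)        ≡⟨ cong (_+ sum (map g R)) (sum-map-suc g J) ⟨
  sum (map (suc ∘ g) J) + sum (map g R)           ≤⟨ +-mono-≤ (sum-map-≤ saving) (sum-map-≤ {g} {L = R} (Listᵃ.tabulate λ _ → g≤B _)) ⟩
  length J * B + length R * B                     ≡⟨ *-distribʳ-+ B (length J) (length R) ⟨
  (length J + length R) * B                       ≡⟨ cong (_* B) (length-++ J) ⟨
  length (J ++ R) * B                             ≡⟨ cong (_* B) (↭.↭-length p) ⟨
  length (upTo a) * B                             ≡⟨ cong (_* B) (length-upTo a) ⟩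
  a * B                                           ∎
  where
  open ≤-Reasoning
  shuffle : ∀ x y z → x + y + z ≡ x + z + y
  shuffle = solve-∀

-- One period of `a` terms is split off at a time; the last `r` terms get only the uniform bound.
sum-periodic-savings : ∀ {B J a} → Unique J → Listᵃ.All (_< a) J → ∀ q r (g : ℕ → ℕ) →
                       (∀ j → g j ≤ B) → (∀ i → Listᵃ.All (λ j → suc (g (i * a + j)) ≤ B) J) →
                       sum (applyUpTo g (q * a + r)) + q * length J ≤ (q * a + r) * B
sum-periodic-savings J! J<a zero r g g≤B saving =
  subst₂ _≤_ (trans (cong sum (map-upTo g r)) (sym (+-identityʳ _)))
    (cong (_* _) (length-upTo r)) (sum-map-≤ {g} {L = upTo r} (Listᵃ.tabulate λ _ → g≤B _))
sum-periodic-savings {B} {J} {a} J! J<a (suc q) r g g≤B saving = begin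
  sum (applyUpTo g (a + q * a + r)) + (w + q * w)        ≡⟨ cong (λ l → sum (applyUpTo g l) + (w + q * w)) (+-assoc a (q * a) r) ⟩
  sum (applyUpTo g (a + (q * a + r))) + (w + q * w)      ≡⟨ cong (λ l → sum l + (w + q * w)) (applyUpTo-+ g a (q * a + r)) ⟩
  sum (applyUpTo g a ++ applyUpTo g′ (q * a + r)) + (w + q * w)
                                                         ≡⟨ cong (_+ (w + q * w)) (sum-++ (applyUpTo g a) _) ⟩
  sum (applyUpTo g a) + sum (applyUpTo g′ (q * a + r)) + (w + q * w)
                                                         ≡⟨ shuffle (sum (applyUpTo g a)) _ w (q * w) ⟩
  (sum (applyUpTo g a) + w) + (sum (applyUpTo g′ (q * a + r)) + q * w)
                                                         ≤⟨ +-mono-≤ (sum-with-savings J! J<a g≤B (saving 0))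
                                                                     (sum-periodic-savings J! J<a q r g′ (g≤B ∘ (a +_)) saving′) ⟩
  a * B + (q * a + r) * B                                ≡⟨ *-distribʳ-+ B a (q * a + r) ⟨
  (a + (q * a + r)) * B                                  ≡⟨ cong (_* B) (+-assoc a (q * a) r) ⟨
  (a + q * a + r) * B                                    ∎
  where
  open ≤-Reasoning
  w = length J
  g′ = g ∘ (a +_)
  saving′ : ∀ i → Listᵃ.All (λ j → suc (g′ (i * a + j)) ≤ B) J
  saving′ i = Listᵃ.map (λ {j} → subst (λ x → suc (g x) ≤ B) (+-assoc a (i * a) j)) (saving (suc i))
  shuffle : ∀ x y z u → x + y + (z + u) ≡ (x + z) + (y + u)
  shuffle = solve-∀


-- Here `q` full periods save `w` each. The last, possibly partial block costs `B`, and the savings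
-- forgone on the remainders `σ` and `ρ * M`, each at most `M * a`, cost `w` apiece. Hence the
-- constant is free of `a`.
totals : ∀ {m M n a q ρ σ B w S} .{{_ : NonZero a}} → n ≡ σ + (ρ + q * a) * M → σ < M → ρ < a →
         m ≤ S → S + q * w ≤ (q * a + suc ρ) * B →
         m * (M * a) + w * n ≤ B * a * n + (B + (w + w)) * (M * a)
totals {m} {M} {_} {a} {q} {ρ} {σ} {B} {w} {S} refl σ<M ρ<a m≤S bound = begin
  m * (M * a) + w * (σ + (ρ + q * a) * M)
    ≡⟨ expand m M a q ρ σ w ⟩
  (m + q * w) * (M * a) + w * σ + w * (ρ * M)
    ≤⟨ +-mono-≤ (+-mono-≤ (*-monoˡ-≤ (M * a) (≤-trans (+-monoˡ-≤ (q * w) m≤S) bound))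
                          (*-monoʳ-≤ w (≤-trans (<⇒≤ σ<M) (m≤m*n M a))))
                (*-monoʳ-≤ w (*-monoˡ-≤ M (<⇒≤ ρ<a))) ⟩
  (q * a + suc ρ) * B * (M * a) + w * (M * a) + w * (a * M)
    ≡⟨ collect M a q ρ B w ⟩
  B * a * ((ρ + q * a) * M) + (B + (w + w)) * (M * a)
    ≤⟨ +-monoˡ-≤ _ (*-monoʳ-≤ (B * a) (m≤n+m _ σ)) ⟩
  B * a * (σ + (ρ + q * a) * M) + (B + (w + w)) * (M * a) ∎
  where
  open ≤-Reasoning
  expand : ∀ m M a q ρ σ w → m * (M * a) + w * (σ + (ρ + q * a) * M)
                           ≡ (m + q * w) * (M * a) + w * σ + w * (ρ * M)
  expand = solve-∀
  collect : ∀ M a q ρ B w → (q * a + suc ρ) * B * (M * a) + w * (M * a) + w * (a * M)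
                          ≡ B * a * ((ρ + q * a) * M) + (B + (w + w)) * (M * a)
  collect = solve-∀

-- A misses at least d elements of every block, and suc d elements of block j if
-- a divides j * M + s for some s ∈ W.  Position 0, used for k = 1, is the
-- integer just before the block.
record Sieve (k M d : ℕ) (W : List ℕ) .{{_ : NonZero M}} : Set where
  field
    fuel gap : ℕ
    plain    : T (search fuel d (plainCliques k M))
    marked   : Listᵃ.All (λ s → T (search fuel (suc d) (markedCliques k M s ++ plainCliques k M))) W
    closed   : ∀ {u} → u < M → Coprime u M → Listᵃ.All (λ t → (t * u) % M ∈ˡ W) W
    W<M      : Listᵃ.All (_< M) W
    gaps     : Listᵖ.AllPairs (λ t t′ → t + gap ≤ t′) W
    0<gap    : 0 < gap
    large    : ∀ {u} → u < M → Coprime u M → u ≢ 1 → M ≤ gap * u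

-- From a sieve to an inequality of natural numbers

module _ {k M d W} .{{_ : NonZero M}} (sieve : Sieve k M d W)
         {A} (A∈C : A ∈ C k) {a} .{{_ : NonZero a}} (a∈A : a ∈ A) (a≢1 : a ≢ 1) (a⊥M : Coprime a M)
  where
  open Sieve sieve

  private
    w = length W
    J = map (λ t → t * a / M) W

  -- If `a < M`, then `a` is one of the finitely many units other than 1 that `large` covers.
  M≤gap*a : M ≤ gap * a
  M≤gap*a with a <? M
  ... | yes a<M = large a<M a⊥M a≢1
  ... | no  a≮M = ≤-trans (≮⇒≥ a≮M) (m≤n*m a gap {{>-nonZero 0<gap}})

  J<a : Listᵃ.All (_< a) J
  J<a = Listᵃ.map⁺ (Listᵃ.map (λ {t} t<M → m<n*o⇒m/o<n (subst (t * a <_) (*-comm M a) (*-monoˡ-< a t<M))) W<M)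

  -- Members of `W` differ by at least `gap`, so their multiples by `a` differ by at least `M` and
  -- fall into different blocks.
  J! : Unique J
  J! = Listᵖ.map⁺ (Listᵖ.map (λ {t} {t′} t+gap≤t′ → <⇒≢ (increasing t t′ t+gap≤t′)) gaps)
    where
    increasing : ∀ t t′ → t + gap ≤ t′ → t * a / M < t′ * a / M
    increasing t t′ t+gap≤t′ = begin
      suc (t * a / M)       ≡⟨ +-comm 1 _ ⟩
      t * a / M + 1         ≡⟨ cong (t * a / M +_) (n/n≡1 M) ⟨
      t * a / M + M / M     ≡⟨ +-distrib-/-∣ʳ (t * a) ∣-refl ⟨
      (t * a + M) / M       ≤⟨ /-monoˡ-≤ M (+-monoʳ-≤ (t * a) M≤gap*a) ⟩
      (t * a + gap * a) / M ≡⟨ cong (_/ M) (*-distribʳ-+ a t gap) ⟨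
      (t + gap) * a / M     ≤⟨ /-monoˡ-≤ M (*-monoˡ-≤ a t+gap≤t′) ⟩
      t′ * a / M            ∎
      where open ≤-Reasoning

  marked-position : ∀ {t} → t ∈ˡ W → (t * a) % M ∈ˡ W
  marked-position {t} t∈W = subst (_∈ˡ W) residue (Listᵃ.lookup (closed (m%n<n a M) a%M⊥M) t∈W)
    where
    a%M⊥M : Coprime (a % M) M
    a%M⊥M (e∣a%M , e∣M) = a⊥M (∣n∣m%n⇒∣m e∣M e∣a%M , e∣M)
    residue : (t * (a % M)) % M ≡ (t * a) % M
    residue = begin
      (t * (a % M)) % M             ≡⟨ %-distribˡ-* t (a % M) M ⟩
      ((t % M) * (a % M % M)) % M   ≡⟨ cong (λ r → ((t % M) * r) % M) (m%n%n≡m%n a M) ⟩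
      ((t % M) * (a % M)) % M       ≡⟨ %-distribˡ-* t a M ⟨
      (t * a) % M                   ∎
      where open ≡-Reasoning

  module _ {xs} (xs⊆A : ∀ {x} → x ∈ˡ xs → x ∈ A) where
    open Blocks A∈C xs⊆A M

    -- The integer `(i * M + t) * a` sits at position `t * a % M` relative to block
    -- `i * a + t * a / M`, and that position is again in `W`.
    saving : ∀ i → Listᵃ.All (λ j → suc (count (i * a + j)) ≤ M ∸ d) J
    saving i = Listᵃ.map⁺ (Listᵃ.tabulate λ {t} t∈W →
      m+n≤o⇒m≤o∸n _ (subst (_≤ M) (+-suc _ d)
        (count-marked-≤ a∈A a⊥M fuel (suc d) (i * a + t * a / M) (t * a % M) (multiple t)
          (Listᵃ.lookup marked (marked-position t∈W)))))
      where
      multiple : ∀ t → a ∣ (i * a + t * a / M) * M + t * a % M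
      multiple t = divides (i * M + t) (begin
        (i * a + t * a / M) * M + t * a % M       ≡⟨ shuffle i a (t * a / M) M (t * a % M) ⟩
        i * M * a + (t * a % M + t * a / M * M)   ≡⟨ cong (i * M * a +_) (m≡m%n+[m/n]*n (t * a) M) ⟨
        i * M * a + t * a                         ≡⟨ *-distribʳ-+ a (i * M) t ⟨
        (i * M + t) * a                           ∎)
        where
        open ≡-Reasoning
        shuffle : ∀ i a x M s → (i * a + x) * M + s ≡ i * M * a + (s + x * M)
        shuffle = solve-∀

    length-≤-sum-count : ∀ {n} → Unique xs → (∀ {x} → x ∈ˡ xs → 1 ≤ x × x ≤ n) →
                         length xs ≤ sum (applyUpTo count (suc (n / M)))
    length-≤-sum-count {n} xs! range = begin
      length xs                             ≤⟨ unique-⊆⇒length-≤ xs! covered ⟩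
      length (concat (applyUpTo block N))   ≡⟨ length-concat-applyUpTo block N ⟩
      sum (applyUpTo (length ∘ block) N)    ≡⟨ cong sum (map-upTo (length ∘ block) N) ⟨
      sum (map (length ∘ block) (upTo N))   ≡⟨ cong sum (map-cong length-block (upTo N)) ⟩
      sum (map count (upTo N))              ≡⟨ cong sum (map-upTo count N) ⟩
      sum (applyUpTo count N)               ∎
      where
      open ≤-Reasoning
      N = suc (n / M)
      block : ℕ → List ℕ
      block j = map (j * M +_) (filter (occupied? j) (positions M))
      length-block : ∀ j → length (block j) ≡ count j
      length-block j = length-map (j * M +_) (filter (occupied? j) (positions M))
      covered : ∀ {x} → x ∈ˡ xs → x ∈ˡ concat (applyUpTo block N)
      covered {zero}  x∈ with () ← proj₁ (range x∈)
      -- Positions run from 1 to `M`, so the block of `suc y` is found by dividing `y`.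
      covered {suc y} x∈ = ∈-concat⁺′
        (subst (_∈ˡ block (y / M)) decompose
          (∈-map⁺ _ (∈-filter⁺ (occupied? (y / M)) (∈-map⁺ suc (∈-upTo⁺ (m%n<n y M)))
                                (subst (_∈ˡ xs) (sym decompose) x∈))))
        (∈-applyUpTo⁺ block (s≤s (/-monoˡ-≤ M (≤-trans (n≤1+n y) (proj₂ (range x∈))))))
        where
        decompose : y / M * M + suc (y % M) ≡ suc y
        decompose = trans (+-suc _ _) (cong suc (trans (+-comm _ (y % M)) (sym (m≡m%n+[m/n]*n y M))))

  -- This is the desired bound multiplied by `M * a`, with the negative term moved to the left so
  -- that everything stays in ℕ.
  linear-bound : ∀ {n m} → ∣ A ⟨ n ⟩ ∣≡ m →
                 m * (M * a) + w * n ≤ (M ∸ d) * a * n + (M ∸ d + (w + w)) * (M * a)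
  linear-bound {n} (xs , xs! , xs≡A , refl) =
    totals {q = e / a} split (m%n<n n M) (m%n<n e a)
      (subst (λ N → length xs ≤ sum (applyUpTo count N)) blocks
        (length-≤-sum-count xs⊆A xs! (proj₂ ∘ Equivalence.to (xs≡A _))))
      (subst (λ l → sum (applyUpTo count (e / a * a + suc (e % a))) + e / a * l ≤ (e / a * a + suc (e % a)) * (M ∸ d))
        (length-map _ W)
        (sum-periodic-savings J! J<a (e / a) (suc (e % a)) count
          (λ j → m+n≤o⇒m≤o∸n _ (count-≤ fuel d plain j)) (saving xs⊆A)))
    where
    e = n / M
    xs⊆A : ∀ {x} → x ∈ˡ xs → x ∈ A
    xs⊆A = proj₁ ∘ Equivalence.to (xs≡A _)
    open Blocks A∈C xs⊆A M
    split : n ≡ n % M + (e % a + e / a * a) * M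
    split = trans (m≡m%n+[m/n]*n n M) (cong (λ z → n % M + z * M) (m≡m%n+[m/n]*n e a))
    blocks : suc e ≡ e / a * a + suc (e % a)
    blocks = trans (cong suc (trans (m≡m%n+[m/n]*n e a) (+-comm (e % a) _))) (sym (+-suc _ _))

-- Members of `A` outside `E k`: distinct from 1 and coprime to `P k`

-- As 1 is coprime to itself, `k + 1` copies of it would be a forbidden tuple.
C⇒1∉ : ∀ k {A} → A ∈ C k → 1 ∉ A
C⇒1∉ k (_ , no-clique) 1∈A = no-clique (Vec.replicate (suc k) 1) (all 1∈A (suc k)) (pairs (suc k))
  where
  all : ∀ {Q : Pred ℕ 0ℓ} → 1 ∈ Q → ∀ r → Vecᵃ.All Q (Vec.replicate r 1)
  all 1∈Q zero    = []
  all 1∈Q (suc r) = 1∈Q ∷ all 1∈Q r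
  pairs : ∀ r → AllPairs Coprime (Vec.replicate r 1)
  pairs zero    = []
  pairs (suc r) = all (λ {d} → Coprimality.1-coprimeTo 1 {d}) r ∷ pairs r

coprime-* : ∀ {a m n} → Coprime a m → Coprime a n → Coprime a (m * n)
coprime-* a⊥m a⊥n (d∣a , d∣mn) =
  a⊥n (d∣a , coprime-divisor (λ (e∣d , e∣m) → a⊥m (∣-trans e∣d d∣a , e∣m)) d∣mn)

prime∤⇒coprime : ∀ {a q} → Prime q → ¬ q ∣ a → Coprime a q
prime∤⇒coprime q-prime q∤a (d∣a , d∣q) with prime⇒irreducible q-prime d∣q
... | inj₁ d≡1  = d≡1
... | inj₂ refl = contradiction d∣a q∤a

-- Primality of the `p i` is a hypothesis, to be settled by evaluation for each concrete `k`.
∉E⇒coprime-P : ∀ k {a} .{{_ : NonZero a}} → (∀ {i} → i < k → Prime (p (suc i))) → a ∉ E k →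
               Coprime a (P k)
∉E⇒coprime-P zero    _      _   = Coprimality.sym (Coprimality.1-coprimeTo _)
∉E⇒coprime-P (suc k) primes a∉E = coprime-*
  (∉E⇒coprime-P k (primes ∘ m<n⇒m<1+n) λ (nz , i , 1≤i , i≤k , q∣a) → a∉E (nz , i , 1≤i , m≤n⇒m≤1+n i≤k , q∣a))
  (prime∤⇒coprime (primes ≤-refl) λ q∣a → a∉E (>-nonZero (>-nonZero⁻¹ _) , suc k , s≤s z≤n , ≤-refl , q∣a))

-- Passage to the rationals

-- Over unnormalised fractions the claim is a single cross-multiplied inequality of integers; the
-- factors 1 are the denominators of the integers involved.
ι-bound : ∀ m n c z d .{{_ : NonZero d}} →
          ℤ.+ m ℤ.* ℤ.+ d ℤ.≤ z ℤ.* ℤ.+ n ℤ.+ ℤ.+ c ℤ.* ℤ.+ d →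
          ι m ℚ.≤ (z ℚ./ d) ℚ.* ι n ℚ.+ ι c
ι-bound m n c z d@(suc d-1) bound = ℚ.toℚᵘ-cancel-≤ (begin
  ℚ.toℚᵘ (ι m)                                     ≃⟨ ℚ.toℚᵘ-fromℚᵘ (mkℚᵘ (ℤ.+ m) 0) ⟩
  mkℚᵘ (ℤ.+ m) 0                                   ≤⟨ *≤* cross ⟩
  mkℚᵘ z d-1 ℚᵘ.* mkℚᵘ (ℤ.+ n) 0 ℚᵘ.+ mkℚᵘ (ℤ.+ c) 0
    ≃⟨ ℚᵘ.+-cong (ℚᵘ.*-cong (ℚ.toℚᵘ-fromℚᵘ (mkℚᵘ z d-1)) (ℚ.toℚᵘ-fromℚᵘ (mkℚᵘ (ℤ.+ n) 0)))
                 (ℚ.toℚᵘ-fromℚᵘ (mkℚᵘ (ℤ.+ c) 0)) ⟨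
  ℚ.toℚᵘ (z ℚ./ d) ℚᵘ.* ℚ.toℚᵘ (ι n) ℚᵘ.+ ℚ.toℚᵘ (ι c)
    ≃⟨ ℚᵘ.+-congˡ (ℚ.toℚᵘ (ι c)) (ℚ.toℚᵘ-homo-* (z ℚ./ d) (ι n)) ⟨
  ℚ.toℚᵘ ((z ℚ./ d) ℚ.* ι n) ℚᵘ.+ ℚ.toℚᵘ (ι c)
    ≃⟨ ℚ.toℚᵘ-homo-+ ((z ℚ./ d) ℚ.* ι n) (ι c) ⟨
  ℚ.toℚᵘ ((z ℚ./ d) ℚ.* ι n ℚ.+ ι c)               ∎)
  where
  open ℚᵘ.≤-Reasoning
  cross : ℤ.+ m ℤ.* ℤ.+ (d * 1 * 1) ℤ.≤ (z ℤ.* ℤ.+ n ℤ.* ℤ.+ 1 ℤ.+ ℤ.+ c ℤ.* ℤ.+ (d * 1)) ℤ.* ℤ.+ 1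
  cross = subst₂ ℤ._≤_
    (cong (λ e → ℤ.+ m ℤ.* ℤ.+ e) (sym (trans (*-identityʳ (d * 1)) (*-identityʳ d))))
    (sym (trans (ℤ.*-identityʳ _)
      (cong₂ ℤ._+_ (ℤ.*-identityʳ (z ℤ.* ℤ.+ n)) (cong (λ e → ℤ.+ c ℤ.* ℤ.+ e) (*-identityʳ d)))))
    bound

ι-linear-bound : ∀ m n c B w a d .{{_ : NonZero d}} → m * d + w * n ≤ B * a * n + c * d →
                 ι m ℚ.≤ ((ℤ.+ B ℤ.* ℤ.+ a ℤ.- ℤ.+ w) ℚ./ d) ℚ.* ι n ℚ.+ ι c
ι-linear-bound m n c B w a d bound = ι-bound m n c (ℤ.+ B ℤ.* ℤ.+ a ℤ.- ℤ.+ w) d (begin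
  ℤ.+ m ℤ.* ℤ.+ d                                     ≡⟨ add-sub (ℤ.+ m ℤ.* ℤ.+ d) (ℤ.+ w ℤ.* ℤ.+ n) ⟩
  ℤ.+ m ℤ.* ℤ.+ d ℤ.+ ℤ.+ w ℤ.* ℤ.+ n ℤ.- ℤ.+ w ℤ.* ℤ.+ n
                                                      ≤⟨ ℤ.+-monoˡ-≤ (ℤ.- (ℤ.+ w ℤ.* ℤ.+ n)) bound′ ⟩
  ℤ.+ B ℤ.* ℤ.+ a ℤ.* ℤ.+ n ℤ.+ ℤ.+ c ℤ.* ℤ.+ d ℤ.- ℤ.+ w ℤ.* ℤ.+ n
                                                      ≡⟨ regroup (ℤ.+ B ℤ.* ℤ.+ a) (ℤ.+ n) (ℤ.+ c ℤ.* ℤ.+ d) (ℤ.+ w) ⟩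
  (ℤ.+ B ℤ.* ℤ.+ a ℤ.- ℤ.+ w) ℤ.* ℤ.+ n ℤ.+ ℤ.+ c ℤ.* ℤ.+ d ∎)
  where
  open ℤ.≤-Reasoning
  add-sub : ∀ x y → x ≡ x ℤ.+ y ℤ.- y
  add-sub = ℤ-Ring.solve-∀
  regroup : ∀ u v x y → u ℤ.* v ℤ.+ x ℤ.- y ℤ.* v ≡ (u ℤ.- y) ℤ.* v ℤ.+ x
  regroup = ℤ-Ring.solve-∀
  bound′ : ℤ.+ m ℤ.* ℤ.+ d ℤ.+ ℤ.+ w ℤ.* ℤ.+ n ℤ.≤ ℤ.+ B ℤ.* ℤ.+ a ℤ.* ℤ.+ n ℤ.+ ℤ.+ c ℤ.* ℤ.+ d
  bound′ rewrite sym (ℤ.pos-* m d) | sym (ℤ.pos-* w n) | sym (ℤ.pos-* B a)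
               | sym (ℤ.pos-* (B * a) n) | sym (ℤ.pos-* c d) = ℤ.+≤+ bound

-- The sieves for k = 1, 2, 3

closed? : ∀ M W .{{_ : NonZero M}} →
          Dec (∀ {u} → u < M → Coprime u M → Listᵃ.All (λ t → (t * u) % M ∈ˡ W) W)
closed? M W = allUpTo? (λ u → coprime? u M →-dec Listᵃ.all? (λ t → (t * u) % M ∈? W) W) M

large? : ∀ M gap → Dec (∀ {u} → u < M → Coprime u M → u ≢ 1 → M ≤ gap * u)
large? M gap = allUpTo? (λ u → coprime? u M →-dec (¬? (u ≟ 1) →-dec M ≤? gap * u)) M

gaps? : ∀ gap W → Dec (Listᵖ.AllPairs (λ t t′ → t + gap ≤ t′) W)
gaps? gap = Listᵖ.allPairs? λ t t′ → t + gap ≤? t′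

primes? : ∀ k → Dec (∀ {i} → i < k → Prime (p (suc i)))
primes? = allUpTo? λ i → prime? (p (suc i))

-- Positions 1 and 2 are both near 0, so a block preceded by a multiple of `a` contains no listed
-- element. No unit below 2 differs from 1, so `large` is vacuous.
sieve₁ : Sieve 1 2 1 (0 ∷ [])
sieve₁ = record
  -- Running out of fuel yields `false`, so any sufficient value will do; the `_` below are proofs
  -- of `T true`, found by evaluating the search.
  { fuel   = 100
  ; gap    = 1
  ; plain  = _
  ; marked = _ ∷ []
  ; closed = from-yes (closed? 2 (0 ∷ []))
  ; W<M    = from-yes (Listᵃ.all? (_<? 2) (0 ∷ []))
  ; gaps   = from-yes (gaps? 1 (0 ∷ []))
  ; 0<gap  = z<s
  ; large  = from-yes (large? 2 1)
  }

-- `W` consists of the residues whose gcd with 6 is 2, and its size is 2 = φ(2)(5 - 3). The only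
-- unit besides 1 is 5, and 6 ≤ 2 * 5.
sieve₂ : Sieve 2 6 2 (2 ∷ 4 ∷ [])
sieve₂ = record
  { fuel   = 100
  ; gap    = 2
  ; plain  = _
  ; marked = _ ∷ _ ∷ []
  ; closed = from-yes (closed? 6 (2 ∷ 4 ∷ []))
  ; W<M    = from-yes (Listᵃ.all? (_<? 6) (2 ∷ 4 ∷ []))
  ; gaps   = from-yes (gaps? 2 (2 ∷ 4 ∷ []))
  ; 0<gap  = z<s
  ; large  = from-yes (large? 6 2)
  }

-- `W` consists of the residues whose gcd with 30 is 3, and its size is 4 = φ(6)(7 - 5). The least
-- unit above 1 is 7, and 30 ≤ 6 * 7.
sieve₃ : Sieve 3 30 8 (3 ∷ 9 ∷ 21 ∷ 27 ∷ [])
sieve₃ = record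
  { fuel   = 100
  ; gap    = 6
  ; plain  = _
  ; marked = _ ∷ _ ∷ _ ∷ _ ∷ []
  ; closed = from-yes (closed? 30 (3 ∷ 9 ∷ 21 ∷ 27 ∷ []))
  ; W<M    = from-yes (Listᵃ.all? (_<? 30) (3 ∷ 9 ∷ 21 ∷ 27 ∷ []))
  ; gaps   = from-yes (gaps? 6 (3 ∷ 9 ∷ 21 ∷ 27 ∷ []))
  ; 0<gap  = z<s
  ; large  = from-yes (large? 30 6)
  }

sieve-bound : ∀ {k M d W} .{{_ : NonZero M}} → Sieve k M d W →
              ∀ (A : Pred ℕ 0ℓ) → A ∈ C k → ∀ a .{{_ : NonZero a}} → a ∈ A → Coprime a M →
              ∀ n m → ∣ A ⟨ n ⟩ ∣≡ m →
              ι m ℚ.≤ ℚ._/_ (ℤ.+ (M ∸ d) ℤ.* ℤ.+ a ℤ.- ℤ.+ length W) (M * a) {{m*n≢0 M a}} ℚ.* ι n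
                        ℚ.+ ι (M ∸ d + (length W + length W))
sieve-bound {k} {M} {d} {W} sieve A A∈C a a∈A a⊥M n m card =
  ι-linear-bound m n (M ∸ d + (length W + length W)) (M ∸ d) (length W) a (M * a) {{m*n≢0 M a}}
    (linear-bound sieve A∈C a∈A (λ { refl → C⇒1∉ k A∈C a∈A }) a⊥M card)

theorem2 : ∀ (k : ℕ) → k ∈ˡ (1 ∷ 2 ∷ 3 ∷ []) →
    Σ[ c ∈ ℚ ] (∀ (A : Pred ℕ 0ℓ) → A ∈ C k →
    ∀ (a : ℕ) → .{{_ : NonZero a}} → a ∈ A → a ∉ E k →
    ∀ (n : ℕ) → .{{_ : NonZero n}} →
    ∀ (m : ℕ) → ∣ A ⟨ n ⟩ ∣≡ m →
    ι m ℚ.≤ slope k a ℚ.* ι n ℚ.+ c)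
-- The constants are `M ∸ d` plus twice `length W`: 1 + 2, 4 + 4 and 22 + 8. Evaluating `P`, `φ` and
-- `p` turns `slope k a` into the fraction of `sieve-bound`.
theorem2 _ (here refl) = ι 3 , λ A A∈C a a∈A a∉E n m →
  sieve-bound sieve₁ A A∈C a a∈A (∉E⇒coprime-P 1 (from-yes (primes? 1)) a∉E) n m
theorem2 _ (there (here refl)) = ι 8 , λ A A∈C a a∈A a∉E n m →
  sieve-bound sieve₂ A A∈C a a∈A (∉E⇒coprime-P 2 (from-yes (primes? 2)) a∉E) n m
theorem2 _ (there (there (here refl))) = ι 30 , λ A A∈C a a∈A a∉E n m →
  sieve-bound sieve₃ A A∈C a a∈A (∉E⇒coprime-P 3 (from-yes (primes? 3)) a∉E) n m
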